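{- Let $T$ be a non-empty finite set of positive integers with largest element $c$. Let $m$ be the smallest nonnegative integer such that for all integers $i\ge m$, \[ \tfrac12 i^2+\left(\tfrac32-c\right)i+\left(1+\tfrac12 c-\tfrac32 c^2\right) > 0, \] and let $d$ be the maximum of $2c+m-1$ and $\max_{ -2c+2\le i\le c+m}\{f_T(i+c)-f_T(i)-f_T(i+1)+i+1\}$. Suppose $k$ is an integer with $k\ge\max\{2d-4c+2,\ 4c+d+1\}$ and \[ k > \max_{ -2c+2\le i\le c+d+2}\{f_T(i-1+c)-f_T(i-1)-f_T(i)+i+2c-1\}. \] Then the $S$-LID sequence $(a_n)_{n\ge1}$ for $S=[k]\setminus(k-T)$ satisfies $a_{n+1}=a_n+a_{n-k}$ for all integers $n>k+c$.
   Context: $[k]=\{1,\dots,k\}$ and $k-T=\{k-t:t\in T\}$. For a set $S$ of positive integers, the $S$-legal index difference ($S$-LID) sequence $(a_n)_{n\ge 1}$ is defined recursively: for each positive integer $n$, $a_n$ is the smallest positive integer that cannot be written as $\sum_{\ell\in L} a_\ell$ for some set $L \subseteq \{1,\dots,n-1\}$ such that $|i-j|\notin S$ for all $i,j\in L$ (the empty sum is $0$). For each positive integer $k$ write $(a^{(k)}_n)$ for the $([k]\setminus(k-T))$-LID sequence. For each integer $i$, $f_T(i)$ denotes the integer such that $a^{(k)}_{k+i}=k+f_T(i)$ for every integer $k$ with $k>-i$ and $k\ge i+2c-1$ (this value is independent of such $k$; e.g. $f_T(i)=i$ for $i\le -c+1$). -}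

module Defs where

open import Data.Bool using (Bool; true; false; if_then_else_; not; _∧_)
open import Data.Nat as ℕ using (ℕ; zero; suc; _≤ᵇ_; _≡ᵇ_)
open import Data.Bool.ListAction using (any; all)
open import Data.Integer as ℤ using (ℤ; +_; -_; _⊔_; _-_; _*_; ∣_∣)
open import Data.List using (List; []; _∷_; map; _++_; length; concatMap)
open import Data.Nat.ListAction using (sum)
open import Data.Product using (_×_; _,_; proj₁; proj₂)

_∈ᵇ_ : ℕ → List ℕ → Bool
x ∈ᵇ xs = any (λ y → x ≡ᵇ y) xs

subsets : {A : Set} → List A → List (List A)
subsets [] = [] ∷ []
subsets (x ∷ xs) = let r = subsets xs in r ++ map (x ∷_) r

-- A set L of indices is S-legal iff |i - j| ∉ S for all i, j ∈ L.
-- S is given as a boolean predicate on ℕ (S contains only positive integers,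
-- so the pairs i = j are harmless).
legal : (ℕ → Bool) → List ℕ → Bool
legal S L = all (λ i → all (λ j → not (S (ℕ.∣ i - j ∣))) L) L

legalSums : (ℕ → Bool) → List (ℕ × ℕ) → List ℕ
legalSums S ps =
  concatMap (λ L → if legal S (map proj₁ L) then sum (map proj₂ L) ∷ [] else [])
            (subsets ps)

mexFrom : ℕ → ℕ → List ℕ → ℕ
mexFrom zero    x xs = x
mexFrom (suc f) x xs = if x ∈ᵇ xs then mexFrom f (suc x) xs else x

-- Smallest positive integer not in xs (fuel length xs + 1 always suffices).
mexPos : List ℕ → ℕ
mexPos xs = mexFrom (suc (length xs)) 1 xs

prefix : (ℕ → Bool) → ℕ → List (ℕ × ℕ)
prefix S zero    = []
prefix S (suc n) = prefix S n ++ ((suc n , mexPos (legalSums S (prefix S n))) ∷ [])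

-- The S-LID sequence: lid S n = a_n for n ≥ 1 (lid S 0 = 0 is a dummy value).
lid : (ℕ → Bool) → ℕ → ℕ
lid S zero    = 0
lid S (suc n) = mexPos (legalSums S (prefix S n))

SkT : ℕ → List ℕ → ℕ → Bool
SkT k T s = (1 ≤ᵇ s) ∧ (s ≤ᵇ k) ∧ not (any (λ t → (s ℕ.+ t) ≡ᵇ k) T)

aK : List ℕ → ℕ → ℕ → ℕ
aK T k n = lid (SkT k T) n

-- f_T(i): a^{(k)}_{k+i} = k + f_T(i) for any k > -i, k ≥ i + 2c - 1;
-- we evaluate at the canonical choice k₀ = max(1, 1 - i, i + 2c - 1)
-- (the context asserts independence of the choice of such k).
fT : List ℕ → ℕ → ℤ → ℤ
fT T c i =
  let k₀ = (+ 1) ⊔ ((+ 1) - i) ⊔ (i ℤ.+ + (2 ℕ.* c) - + 1)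
  in + aK T ∣ k₀ ∣ ∣ k₀ ℤ.+ i ∣ - k₀

maxFrom : ℤ → ℕ → (ℤ → ℤ) → ℤ
maxFrom lo zero    g = g lo
maxFrom lo (suc n) g = g lo ⊔ maxFrom (lo ℤ.+ + 1) n g

-- max_{lo ≤ i ≤ hi} g i   (only used with lo ≤ hi)
maxRange : ℤ → ℤ → (ℤ → ℤ) → ℤ
maxRange lo hi g = maxFrom lo ∣ hi - lo ∣ g

-- The quadratic (1/2) i² + (3/2 - c) i + (1 + c/2 - 3c²/2), multiplied by 2.
twiceQuad : ℕ → ℤ → ℤ
twiceQuad c i = i * i ℤ.+ (+ 3 - + (2 ℕ.* c)) * i ℤ.+ (+ 2 ℤ.+ + c - + (3 ℕ.* c ℕ.* c))

GoodM : ℕ → ℕ → Set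
GoodM c m = ∀ (i : ℤ) → + m ℤ.≤ i → + 0 ℤ.< twiceQuad c i

dVal : List ℕ → ℕ → ℕ → ℤ
dVal T c m =
  (+ (2 ℕ.* c ℕ.+ m) - + 1) ⊔
  maxRange (+ 2 - + (2 ℕ.* c)) (+ (c ℕ.+ m))
    (λ i → fT T c (i ℤ.+ + c) - fT T c i - fT T c (i ℤ.+ + 1) ℤ.+ i ℤ.+ + 1)

{-# OPTIONS --safe #-}
-- Write k = h + c and a = a^(k). Every legal gap is at least h, so a legal sum with top index l is a_l plus a legal
-- sum of indices at most l − h; in particular a_n = n for n ≤ h + 1. Indices at distance more than k are always
-- compatible, so a_n + a_{n−k} ≤ a_{n+1}, and equality holds as soon as a_n + a_{n−k} exceeds every legal sum of
-- indices below n. With q = n − k − 1 this reduces to showing that all legal sums of indices up to q + c are below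
-- a_q + a_{q+1}, which follows from the surplus inequality  a_{q+c} + a_{q+1−d} ≤ a_q + a_{q+1},  because the part
-- of a legal sum under a_{q+c} only involves indices that are far below q + 1 − d. The surplus inequality is trivial
-- while a is the identity; for q near k it is what the definition of d says; and it propagates upwards because it
-- is linear in a and a satisfies the recurrence at smaller indices. Reading it off from d requires that
-- a^(k)_{k+i} − k does not depend on k: in the relevant range a legal sum has at most two terms, the smaller one
-- lying in the identity range, so raising k by one shifts every such sum by one.
module Submission where

open import Defs
open import Data.Bool using (Bool; true; false; if_then_else_; not) renaming (T to IsTrue)
open import Data.Bool.ListAction using (any)
open import Data.Bool.Properties using (T-≡; T-not-≡; T-∧)
open import Data.Fin using (Fin; toℕ)
open import Data.Fin.Properties using (pigeonhole; toℕ<n)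
open import Data.Integer as ℤ using (ℤ; +_; -_; _-_; _⊔_)
import Data.Integer.Properties as ℤ
open import Data.Integer.Tactic.RingSolver using () renaming (solve to solveℤ)
open import Data.List using (List; []; _∷_; _++_; map; length; lookup)
open import Data.List.Membership.Propositional using (_∈_; find; lose)
open import Data.List.Membership.Propositional.Properties using (∈-++⁺ˡ; ∈-++⁺ʳ; ∈-++⁻; ∈-map⁺; ∈-map⁻; ∈-concatMap⁺; ∈-concatMap⁻)
open import Data.List.Properties using (map-++)
open import Data.List.Relation.Unary.All as All using (All)
open import Data.List.Relation.Unary.All.Properties using (all⁺; all⁻)
open import Data.List.Relation.Unary.Any using (here; there; index)
open import Data.List.Relation.Unary.Any.Properties using (any⁺; any⁻; lookup-index)
open import Data.Nat as ℕ using (ℕ; zero; suc; _≤_; _<_; _+_; _*_; _∸_; z≤n; s≤s; ∣_-_∣; _≡ᵇ_; _≤ᵇ_)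
open import Data.Nat.Induction using (<-rec)
open import Data.Nat.ListAction using (sum)
open import Data.Nat.ListAction.Properties using (sum-++)
open import Data.Nat.Properties
open import Data.Nat.Tactic.RingSolver using (solve)
open import Data.Product using (∃; _×_; _,_; proj₁; proj₂)
open import Data.Sum using (_⊎_; inj₁; inj₂; [_,_]′)
open import Function.Bundles using (Equivalence)
open import Relation.Binary.PropositionalEquality using (_≡_; refl; sym; trans; cong; cong₂; subst; subst₂; module ≡-Reasoning)
open import Relation.Nullary using (¬_; yes; no; contradiction)

open Equivalence using (to; from)

-- Linear arithmetic

-- A Farkas certificate: x ≤ y is read off a known A ≤ B with slack s.
linear : ∀ {A B} x y s → A ≤ B → y + A ≡ s + (x + B) → x ≤ y
linear {A} {B} x y s A≤B e = +-cancelʳ-≤ B x y (begin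
  x + B        ≤⟨ m≤n+m (x + B) s ⟩
  s + (x + B)  ≡⟨ e ⟨
  y + A        ≤⟨ +-monoʳ-≤ y A≤B ⟩
  y + B        ∎)
  where open ≤-Reasoning

infixr 5 _⊕_
_⊕_ : ∀ {A B C D} → A ≤ B → C ≤ D → A + C ≤ B + D
_⊕_ = +-mono-≤

near-gap : ∀ k q g j t → suc (k + q) ≤ g + j → g + t ≤ k → 1 ≤ t → suc q < j
near-gap k q g j t p r s = linear (suc (suc q)) j 0 (p ⊕ r ⊕ s) (solve (k ∷ q ∷ g ∷ j ∷ t ∷ []))

early-top≤1+h : ∀ h c i y D → suc (h + c + i) ≤ y + D → y ≤ h → D ≤ h → i + c ≤ suc h
early-top≤1+h h c i y D p q r = linear (i + c) (suc h) 2 (p ⊕ q ⊕ r) (solve (h ∷ c ∷ i ∷ y ∷ D ∷ []))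

-- From `y ≤ k + c` follows `i < c + D`, so the lower bound on `h` still puts `i + c` in the range
-- where `a` is the identity.
middle-top≤1+h : ∀ h c i y D → suc (h + c + i) ≤ y + D → y ≤ h + c + c → c + c + c + D < h → i + c ≤ suc h
middle-top≤1+h h c i y D p q r = linear (i + c) (suc h) (3 + c) (p ⊕ q ⊕ r) (solve (h ∷ c ∷ i ∷ y ∷ D ∷ []))

-- The hypotheses give `w + c ≤ i`. The strictness of `c + c < D` is spent exactly: with `D = c + c`
-- this estimate misses by one, which is why `c = 1` is treated apart.
middle-increment : ∀ h c i w D Y → w + h + D ≤ suc (h + c + i) → c + c < D → (i + c) + (Y + (w + 1)) ≤ Y + (i + suc i)
middle-increment h c i w D Y p q = linear ((i + c) + (Y + (w + 1))) (Y + (i + suc i)) 0 (p ⊕ q) (solve (h ∷ c ∷ i ∷ w ∷ D ∷ Y ∷ []))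

+-∸-≤ : ∀ {c D n} → c ≤ D → c ≤ n → c + (n ∸ D) ≤ n
+-∸-≤ {c} {D} {n} c≤D c≤n with ≤-total D n
... | inj₁ D≤n = subst (c + (n ∸ D) ≤_) (m+[n∸m]≡n D≤n) (+-monoˡ-≤ (n ∸ D) c≤D)
... | inj₂ n≤D rewrite m≤n⇒m∸n≡0 n≤D | +-identityʳ c = c≤n

D≤1+q : ∀ h c q D → suc h < q + c → c + c + c + D < h → D ≤ suc q
D≤1+q h c q D p r = linear D (suc q) (4 + c + c) (p ⊕ r) (solve (h ∷ c ∷ q ∷ D ∷ []))

1+q≤D+1+h : ∀ h c q D → q ≤ h + c + c → c + c ≤ D → suc q ≤ D + suc h
1+q≤D+1+h h c q D p r = linear (suc q) (D + suc h) 0 (p ⊕ r) (solve (h ∷ c ∷ q ∷ D ∷ []))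

-- One step of the surplus inequality: the first hypothesis is the inequality at k + i, the last two are superadditivity.
surplus-combine : ∀ P u y′ y B C e f B′ C′ → P + y ≤ B + C → u + y′ ≤ y + (e + f) → B + e ≤ B′ → C + f ≤ C′ → P + u + y′ ≤ B′ + C′
surplus-combine P u y′ y B C e f B′ C′ p q r s = linear (P + u + y′) (B′ + C′) 0 (p ⊕ q ⊕ r ⊕ s)
  (solve (P ∷ u ∷ y′ ∷ y ∷ B ∷ C ∷ e ∷ f ∷ B′ ∷ C′ ∷ []))

early-increment : ∀ c i y → c ≤ i → i + c + suc y ≤ y + (i + suc i)
early-increment c i y p = linear (i + c + suc y) (y + (i + suc i)) 0 p (solve (c ∷ i ∷ y ∷ []))

+-period-cancel : ∀ k D q i → suc (k + q) + D ≡ suc (k + i) → q + D ≡ i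
+-period-cancel k D q i e = +-cancelˡ-≡ (suc k) (q + D) i (trans (sym (+-assoc (suc k) q D)) e)

-- A second gap of at least `h` pushes the rest of a sum below `suc q - D` with `c + c + 2` indices
-- to spare; the lower bound on `h` leaves no further slack.
tail-room : ∀ h c q D x → x + h ≤ q + c → c + c + c + D < h → x + (c + c) + 2 + D ≤ suc q
tail-room h c q D x p r = linear (x + (c + c) + 2 + D) (suc q) 0 (p ⊕ r) (solve (h ∷ c ∷ q ∷ D ∷ x ∷ []))

∸-room : ∀ h c x → 1 ≤ c → x < h + c + c → x ∸ h + 1 ≤ c + c
∸-room h c x 1≤c p = subst (_≤ c + c) (+-comm 1 (x ∸ h)) (m<n+o⇒m∸n<o x h {{ℕ.>-nonZero (≤-trans 1≤c (m≤m+n c c))}} (subst (x <_) (+-assoc h c c) p))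

two-gaps-earlier : ∀ h c q r → 1 ≤ h → h + c + r + h ≤ q + c → r < q
two-gaps-earlier h c q r p s = linear (suc r) q h (p ⊕ s) (solve (h ∷ c ∷ q ∷ r ∷ []))

k-room⇒h-room : ∀ h c D → 4 * c + 1 + D ≤ h + c → c + c + c + D < h
k-room⇒h-room h c D p = linear (suc (c + c + c + D)) h 0 p (solve (h ∷ c ∷ D ∷ []))

offset+2≤3c : ∀ h c q j → q + c ≡ h + 2 + j → q ≤ h + c + c → j + 2 ≤ c + c + c
offset+2≤3c h c q j e p = linear (j + 2) (c + c + c) 0 (p ⊕ ≤-reflexive (sym e)) (solve (h ∷ c ∷ q ∷ j ∷ []))

window-room : ∀ h c D q x → x ≤ q + c → q ≤ h + c + c → c + c + c + D < h → x + (c + c) ≤ suc (h + c + (h + c))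
window-room h c D q x p r s = linear (x + (c + c)) (suc (h + c + (h + c))) (2 + D) (p ⊕ r ⊕ s) (solve (h ∷ c ∷ D ∷ q ∷ x ∷ []))

room⇒c≤k : ∀ n c k → 1 ≤ n → n + (c + c) ≤ suc (k + k) → c ≤ k
room⇒c≤k n c k p q = ≮⇒≥ λ k<c → 1+n≰n (absurd k<c)
  where
  absurd : k < c → 1 ≤ 0
  absurd r = linear 1 0 1 (p ⊕ q ⊕ r ⊕ r) (solve (n ∷ c ∷ k ∷ []))

room⇒n≤1+2h : ∀ h c n → n + (c + c) ≤ suc (h + c + (h + c)) → n ≤ suc (h + h)
room⇒n≤1+2h h c n p = linear n (suc (h + h)) 0 p (solve (h ∷ c ∷ n ∷ []))

room-shift : ∀ j κ ν c → ν + (c + c) ≤ suc (κ + κ) → j + ν + (c + c) ≤ suc (j + κ + (j + κ))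
room-shift j κ ν c p = linear (j + ν + (c + c)) (suc (j + κ + (j + κ))) j p (solve (j ∷ κ ∷ ν ∷ c ∷ []))

1≤m⇒2≤D : ∀ m D → 1 ≤ m → 2 + m ≤ suc D → 2 ≤ D
1≤m⇒2≤D m D p q = linear 2 D 0 (p ⊕ q) (solve (m ∷ D ∷ []))

2≤m⇒2c<D : ∀ c m D → 2 ≤ m → 2 * c + m ≤ suc D → c + c < D
2≤m⇒2c<D c m D p q = linear (suc (c + c)) D 0 (p ⊕ q) (solve (c ∷ m ∷ D ∷ []))

window⇒1≤q : ∀ h c D q → suc h < q + c → c + c + c + D < h → 1 ≤ q
window⇒1≤q h c D q p r = linear 1 q (2 + c + c + D) (p ⊕ r) (solve (h ∷ c ∷ D ∷ q ∷ []))

linearℤ : ∀ {A B x y} → A ℤ.≤ B → y - x ≡ B - A → x ℤ.≤ y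
linearℤ A≤B e = ℤ.0≤i-j⇒j≤i (subst (+ 0 ℤ.≤_) (sym e) (ℤ.i≤j⇒0≤j-i A≤B))

1-i≤K⇒1≤K+i : ∀ K i → + 1 - i ℤ.≤ K → + 1 ℤ.≤ K ℤ.+ i
1-i≤K⇒1≤K+i K i p = linearℤ p (solveℤ (K ∷ i ∷ []))

i+C-1≤K⇒K+i+C≤1+2K : ∀ K i C → i ℤ.+ C - + 1 ℤ.≤ K → (K ℤ.+ i) ℤ.+ C ℤ.≤ + 1 ℤ.+ (K ℤ.+ K)
i+C-1≤K⇒K+i+C≤1+2K K i C p = linearℤ p (solveℤ (K ∷ i ∷ C ∷ []))

1≤k+i⇒1-i≤k : ∀ k i q → q ≡ k ℤ.+ i → + 1 ℤ.≤ q → + 1 - i ℤ.≤ k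
1≤k+i⇒1-i≤k k i q refl p = linearℤ p (solveℤ (k ∷ i ∷ []))

k+i+C≤1+2k⇒i+C-1≤k : ∀ k i q C → q ≡ k ℤ.+ i → q ℤ.+ C ℤ.≤ + 1 ℤ.+ (k ℤ.+ k) → i ℤ.+ C - + 1 ℤ.≤ k
k+i+C≤1+2k⇒i+C-1≤k k i q C refl p = linearℤ p (solveℤ (k ∷ i ∷ C ∷ []))

+-cancelˡ-difference : ∀ j A κ → (j ℤ.+ A) - (j ℤ.+ κ) ≡ A - κ
+-cancelˡ-difference j A κ = solveℤ (j ∷ A ∷ κ ∷ [])

-- With u, v, w = a (q + c), a q, a (suc q), the hypothesis bounds the term of d at i = q − k.
dTerm⇒surplus : ∀ u v w k q D i → q ≡ k ℤ.+ i → (u - k) - (v - k) - (w - k) ℤ.+ i ℤ.+ + 1 ℤ.≤ D →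
     u ℤ.+ (+ 1 ℤ.+ q) ℤ.≤ D ℤ.+ (v ℤ.+ w)
dTerm⇒surplus u v w k q D i refl p = linearℤ p (solveℤ (u ∷ v ∷ w ∷ k ∷ D ∷ i ∷ []))

-- The offset `j` counts from the lower end `2 - 2c` of the range in the definition of `d`; at that
-- end `q + c` is `h + 2`.
index-from-offset : ∀ q c h j → q ℤ.+ c ≡ h ℤ.+ + 2 ℤ.+ j → q ≡ (h ℤ.+ c) ℤ.+ (+ 2 - + 2 ℤ.* c ℤ.+ j)
index-from-offset q c h j e = begin
  q                                              ≡⟨ solveℤ (q ∷ c ∷ []) ⟩
  (q ℤ.+ c) - c                                  ≡⟨ cong (_- c) e ⟩
  (h ℤ.+ + 2 ℤ.+ j) - c                          ≡⟨ solveℤ (h ∷ c ∷ j ∷ []) ⟩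
  (h ℤ.+ c) ℤ.+ (+ 2 - + 2 ℤ.* c ℤ.+ j)          ∎
  where open ≡-Reasoning

offset≤range : ∀ j c m → j ℤ.+ + 2 ℤ.≤ c ℤ.+ c ℤ.+ c → + 0 ℤ.≤ m → j ℤ.≤ (c ℤ.+ m) - (+ 2 - + 2 ℤ.* c)
offset≤range j c m p q = linearℤ (ℤ.+-mono-≤ p q) (solveℤ (j ∷ c ∷ m ∷ []))

index-+ : ∀ q k i x → q ≡ k ℤ.+ i → q ℤ.+ x ≡ k ℤ.+ (i ℤ.+ x)
index-+ q k i x refl = ℤ.+-assoc k i x

x-1≤D⇒x≤1+D : ∀ x D → x - + 1 ℤ.≤ D → x ℤ.≤ + 1 ℤ.+ D
x-1≤D⇒x≤1+D x D p = linearℤ p (solveℤ (x ∷ D ∷ []))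

-- Maxima over integer ranges, and the quadratic that determines `m`

maxFrom-≥ : ∀ lo n g j → j ≤ n → g (lo ℤ.+ + j) ℤ.≤ maxFrom lo n g
maxFrom-≥ lo zero    g zero    z≤n = ℤ.≤-reflexive (cong g (ℤ.+-identityʳ lo))
maxFrom-≥ lo (suc n) g zero    z≤n = ℤ.≤-trans (ℤ.≤-reflexive (cong g (ℤ.+-identityʳ lo))) (ℤ.i≤i⊔j _ _)
maxFrom-≥ lo (suc n) g (suc j) (s≤s j≤n) = ℤ.≤-trans
  (subst (λ i → g i ℤ.≤ maxFrom (lo ℤ.+ + 1) n g) (ℤ.+-assoc lo (+ 1) (+ j)) (maxFrom-≥ (lo ℤ.+ + 1) n g j j≤n))
  (ℤ.i≤j⊔i (g lo) (maxFrom (lo ℤ.+ + 1) n g))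

twiceQuad-pos : ∀ c i → twiceQuad c i ≡
  i ℤ.* i ℤ.+ (+ 3 - + 2 ℤ.* + c) ℤ.* i ℤ.+ (+ 2 ℤ.+ + c - + 3 ℤ.* + c ℤ.* + c)
twiceQuad-pos c i = cong₂ (λ u v → i ℤ.* i ℤ.+ (+ 3 - u) ℤ.* i ℤ.+ (+ 2 ℤ.+ + c - v))
  (ℤ.pos-* 2 c) (trans (ℤ.pos-* (3 * c) c) (cong (λ r → r ℤ.* + c) (ℤ.pos-* 3 c)))

-- Setting `c = 2 + e` exhibits the value as minus a positive natural number, so its sign can be
-- read off.
twiceQuad-1 : ∀ e → twiceQuad (2 + e) (+ 1) ≡ - + (8 + 13 * e + 3 * (e * e))
twiceQuad-1 e = begin
  twiceQuad (2 + e) (+ 1)                                  ≡⟨ twiceQuad-pos (2 + e) (+ 1) ⟩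
  + 1 ℤ.* + 1 ℤ.+ (+ 3 - + 2 ℤ.* (+ 2 ℤ.+ x)) ℤ.* + 1
    ℤ.+ (+ 2 ℤ.+ (+ 2 ℤ.+ x) - + 3 ℤ.* (+ 2 ℤ.+ x) ℤ.* (+ 2 ℤ.+ x))
                                                           ≡⟨ identity x ⟩
  - (+ 8 ℤ.+ + 13 ℤ.* x ℤ.+ + 3 ℤ.* (x ℤ.* x))             ≡⟨ cong -_ (cong₂ (λ u v → + 8 ℤ.+ u ℤ.+ v) (sym (ℤ.pos-* 13 e))
                                                                (trans (cong (λ r → + 3 ℤ.* r) (sym (ℤ.pos-* e e))) (sym (ℤ.pos-* 3 (e * e))))) ⟩
  - + (8 + 13 * e + 3 * (e * e))                           ∎
  where
  open ≡-Reasoning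
  x = + e
  identity : ∀ x → + 1 ℤ.* + 1 ℤ.+ (+ 3 - + 2 ℤ.* (+ 2 ℤ.+ x)) ℤ.* + 1
                   ℤ.+ (+ 2 ℤ.+ (+ 2 ℤ.+ x) - + 3 ℤ.* (+ 2 ℤ.+ x) ℤ.* (+ 2 ℤ.+ x))
                   ≡ - (+ 8 ℤ.+ + 13 ℤ.* x ℤ.+ + 3 ℤ.* (x ℤ.* x))
  identity x = solveℤ (x ∷ [])

-- Already i = 1 violates the quadratic inequality.
GoodM⇒2≤m : ∀ c m → 2 ≤ c → GoodM c m → 2 ≤ m
GoodM⇒2≤m (suc (suc e)) m (s≤s (s≤s _)) good = ≮⇒≥ λ { (s≤s m≤1) →
  ℤ.<⇒≱ (subst (+ 0 ℤ.<_) (twiceQuad-1 e) (good (+ 1) (ℤ.+≤+ m≤1))) ℤ.-≤+ }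

-- For `c = 1` the doubled quadratic is `i * i + i`, which vanishes at 0.
GoodM1⇒1≤m : ∀ m → GoodM 1 m → 1 ≤ m
GoodM1⇒1≤m m good = ≮⇒≥ λ { (s≤s m≤0) → ℤ.<-irrefl refl (good (+ 0) (ℤ.+≤+ m≤0)) }

-- Opened only now: overloaded list constructors would make the variable lists passed to solve ambiguous.
open import Data.List.Relation.Unary.All using ([]; _∷_)

-- The mex and legal sums

∈ᵇ⇒∈ : ∀ x xs → IsTrue (x ∈ᵇ xs) → x ∈ xs
∈ᵇ⇒∈ x xs p with y , y∈xs , x≡y ← find (any⁻ (x ≡ᵇ_) xs p) = subst (_∈ xs) (sym (≡ᵇ⇒≡ x y x≡y)) y∈xs

∈⇒∈ᵇ : ∀ x xs → x ∈ xs → IsTrue (x ∈ᵇ xs)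
∈⇒∈ᵇ x xs x∈xs = any⁺ (x ≡ᵇ_) (lose x∈xs (≡⇒≡ᵇ x x refl))

mexFrom-≥ : ∀ f x xs → x ≤ mexFrom f x xs
mexFrom-≥ zero    x xs = ≤-refl
mexFrom-≥ (suc f) x xs with x ∈ᵇ xs
... | true  = ≤-trans (n≤1+n x) (mexFrom-≥ f (suc x) xs)
... | false = ≤-refl

mexFrom-below : ∀ f x xs y → x ≤ y → y < mexFrom f x xs → y ∈ xs
mexFrom-below zero    x xs y x≤y y<x = contradiction x≤y (<⇒≱ y<x)
mexFrom-below (suc f) x xs y x≤y y<m with x ∈ᵇ xs in eq
... | false = contradiction x≤y (<⇒≱ y<m)
... | true with m≤n⇒m<n∨m≡n x≤y
...   | inj₁ x<y  = mexFrom-below f (suc x) xs y x<y y<m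
...   | inj₂ refl = ∈ᵇ⇒∈ x xs (from T-≡ eq)

mexFrom-∉⊎exhausted : ∀ f x xs → ¬ (mexFrom f x xs ∈ xs) ⊎ (mexFrom f x xs ≡ f + x)
mexFrom-∉⊎exhausted zero    x xs = inj₂ refl
mexFrom-∉⊎exhausted (suc f) x xs with x ∈ᵇ xs in eq
... | false = inj₁ λ x∈xs → subst IsTrue eq (∈⇒∈ᵇ x xs x∈xs)
... | true with mexFrom-∉⊎exhausted f (suc x) xs
...   | inj₁ ∉ = inj₁ ∉
...   | inj₂ e = inj₂ (trans e (+-suc f x))

-- Pigeonhole on positions: two of the values would sit at the same position of `xs` and hence be
-- equal.
initialSegment⊈shorter : ∀ (xs : List ℕ) → ¬ ((i : Fin (suc (length xs))) → suc (toℕ i) ∈ xs)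
initialSegment⊈shorter xs mem
  with i , j , i<j , e ← pigeonhole (n<1+n (length xs)) (λ i → index (mem i))
  = <⇒≢ i<j (suc-injective
      (trans (lookup-index (mem i)) (trans (cong (lookup xs) e) (sym (lookup-index (mem j))))))

mexPos-≥1 : ∀ xs → 1 ≤ mexPos xs
mexPos-≥1 xs = mexFrom-≥ (suc (length xs)) 1 xs

mexPos-below : ∀ xs y → 1 ≤ y → y < mexPos xs → y ∈ xs
mexPos-below xs = mexFrom-below (suc (length xs)) 1 xs

mexPos-∉ : ∀ xs → ¬ (mexPos xs ∈ xs)
mexPos-∉ xs with mexFrom-∉⊎exhausted (suc (length xs)) 1 xs
... | inj₁ ∉ = ∉
-- With the fuel exhausted the mex would be `length xs + 2`, so 1, ..., `length xs + 1` would all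
-- occur in `xs`.
... | inj₂ e = λ _ → initialSegment⊈shorter xs λ i → mexPos-below xs (suc (toℕ i)) (s≤s z≤n)
  (subst (suc (toℕ i) <_) (sym (trans e (+-comm (suc (length xs)) 1))) (s≤s (toℕ<n i)))

-- `subsets` recurses from the front while `prefix` grows at the end; this lemma and the next two
-- reconcile the two directions.
subsets-++⁺ˡ : ∀ {A : Set} xs {y : A} {P} → P ∈ subsets xs → P ∈ subsets (xs ++ y ∷ [])
subsets-++⁺ˡ [] (here refl) = here refl
subsets-++⁺ˡ (x ∷ xs) p with ∈-++⁻ (subsets xs) p
... | inj₁ q = ∈-++⁺ˡ (subsets-++⁺ˡ xs q)
... | inj₂ q with Q , Q∈ , refl ← ∈-map⁻ (x ∷_) q = ∈-++⁺ʳ (subsets (xs ++ _)) (∈-map⁺ (x ∷_) (subsets-++⁺ˡ xs Q∈))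

subsets-++⁺ʳ : ∀ {A : Set} xs {y : A} {P} → P ∈ subsets xs → P ++ y ∷ [] ∈ subsets (xs ++ y ∷ [])
subsets-++⁺ʳ [] (here refl) = there (here refl)
subsets-++⁺ʳ (x ∷ xs) p with ∈-++⁻ (subsets xs) p
... | inj₁ q = ∈-++⁺ˡ (subsets-++⁺ʳ xs q)
... | inj₂ q with Q , Q∈ , refl ← ∈-map⁻ (x ∷_) q = ∈-++⁺ʳ (subsets (xs ++ _)) (∈-map⁺ (x ∷_) (subsets-++⁺ʳ xs Q∈))

subsets-++⁻ : ∀ {A : Set} xs {y : A} {P} → P ∈ subsets (xs ++ y ∷ []) →
              P ∈ subsets xs ⊎ ∃ λ Q → Q ∈ subsets xs × P ≡ Q ++ y ∷ []
subsets-++⁻ [] (here refl)         = inj₁ (here refl)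
subsets-++⁻ [] (there (here refl)) = inj₂ ([] , here refl , refl)
subsets-++⁻ (x ∷ xs) p with ∈-++⁻ (subsets (xs ++ _)) p
... | inj₁ q with subsets-++⁻ xs q
...   | inj₁ r            = inj₁ (∈-++⁺ˡ r)
...   | inj₂ (Q , r , eq) = inj₂ (Q , ∈-++⁺ˡ r , eq)
subsets-++⁻ (x ∷ xs) p | inj₂ q with P′ , P′∈ , refl ← ∈-map⁻ (x ∷_) q with subsets-++⁻ xs P′∈
...   | inj₁ r              = inj₁ (∈-++⁺ʳ (subsets xs) (∈-map⁺ (x ∷_) r))
...   | inj₂ (Q , r , refl) = inj₂ (x ∷ Q , ∈-++⁺ʳ (subsets xs) (∈-map⁺ (x ∷_) r) , refl)

∈-map-++⁺ˡ : ∀ {A B : Set} {f : A → B} xs {ys y} → y ∈ map f xs → y ∈ map f (xs ++ ys)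
∈-map-++⁺ˡ xs {ys} {y} y∈ = subst (y ∈_) (sym (map-++ _ xs ys)) (∈-++⁺ˡ y∈)

legal⁻ : ∀ S L {i j} → IsTrue (legal S L) → i ∈ L → j ∈ L → S ∣ i - j ∣ ≡ false
legal⁻ S L p i∈ j∈ = to T-not-≡ (All.lookup (all⁺ _ L (All.lookup (all⁺ _ L p) i∈)) j∈)

legal⁺ : ∀ S L → (∀ {i j} → i ∈ L → j ∈ L → S ∣ i - j ∣ ≡ false) → IsTrue (legal S L)
legal⁺ S L p = all⁻ _ (All.tabulate λ i∈ → all⁻ _ (All.tabulate λ j∈ → from T-not-≡ (p i∈ j∈)))

legalSums⁻ : ∀ S ps {x} → x ∈ legalSums S ps →
             ∃ λ P → P ∈ subsets ps × IsTrue (legal S (map proj₁ P)) × x ≡ sum (map proj₂ P)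
legalSums⁻ S ps {x} x∈ with find (∈-concatMap⁻ _ {xs = subsets ps} x∈)
... | P , P∈ , x∈f = P , P∈ , claim x∈f
  where
  claim : x ∈ (if legal S (map proj₁ P) then sum (map proj₂ P) ∷ [] else []) →
          IsTrue (legal S (map proj₁ P)) × x ≡ sum (map proj₂ P)
  claim q with legal S (map proj₁ P)
  claim (here refl) | true = _ , refl

legalSums⁺ : ∀ S ps P → P ∈ subsets ps → IsTrue (legal S (map proj₁ P)) → sum (map proj₂ P) ∈ legalSums S ps
legalSums⁺ S ps P P∈ ok = ∈-concatMap⁺ _ (lose P∈ claim)
  where
  claim : sum (map proj₂ P) ∈ (if legal S (map proj₁ P) then sum (map proj₂ P) ∷ [] else [])
  claim with legal S (map proj₁ P)
  ... | true = here refl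

-- Index sets are listed in decreasing order.
data Legal (S : ℕ → Bool) : ℕ → List ℕ → Set where
  []   : Legal S zero []
  skip : ∀ {n L} → Legal S n L → Legal S (suc n) L
  take : ∀ {n L} → All (λ j → S (suc n ∸ j) ≡ false) L → Legal S n L → Legal S (suc n) (suc n ∷ L)

-- The sequence of a general set: legal sums as decreasing index lists, and monotonicity

module LID (S : ℕ → Bool) (S0 : S 0 ≡ false) where

  a : ℕ → ℕ
  a = lid S

  total : List ℕ → ℕ
  total L = sum (map a L)

  IsSum : ℕ → ℕ → Set
  IsSum n x = ∃ λ L → Legal S n L × total L ≡ x

  empty : ∀ n → Legal S n []
  empty zero    = []
  empty (suc n) = skip (empty n)

  Legal-mono : ∀ {m n L} → m ≤ n → Legal S m L → Legal S n L
  Legal-mono {n = zero}  z≤n p = p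
  Legal-mono {n = suc n} m≤n p with m≤n⇒m<n∨m≡n m≤n
  ... | inj₁ (s≤s m≤n′) = skip (Legal-mono m≤n′ p)
  ... | inj₂ refl       = p

  Legal-bounds : ∀ {n L} → Legal S n L → All (λ j → 1 ≤ j × j ≤ n) L
  Legal-bounds []         = []
  Legal-bounds (skip p)   = All.map (λ (l , u) → l , m≤n⇒m≤1+n u) (Legal-bounds p)
  Legal-bounds (take _ p) = (s≤s z≤n , ≤-refl) ∷ All.map (λ (l , u) → l , m≤n⇒m≤1+n u) (Legal-bounds p)

  Legal-uncons : ∀ {n l L} → Legal S n (l ∷ L) →
                 1 ≤ l × l ≤ n × Legal S (l ∸ 1) L × All (λ j → S (l ∸ j) ≡ false) L
  Legal-uncons (skip p) with 1≤l , l≤n , q , f ← Legal-uncons p = 1≤l , m≤n⇒m≤1+n l≤n , q , f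
  Legal-uncons (take f p) = s≤s z≤n , ≤-refl , p , f

  Legal-anchor : ∀ {n l L} → Legal S n (l ∷ L) → Legal S l (l ∷ L)
  Legal-anchor (skip p)   = Legal-anchor p
  Legal-anchor (take f p) = take f p

  Legal-cons : ∀ {q l L} → q < l → Legal S q L → All (λ j → S (l ∸ j) ≡ false) L → Legal S l (l ∷ L)
  Legal-cons (s≤s q≤l) p f = take f (Legal-mono q≤l p)

  -- The form in which a decreasing index list occurs among the subsets of `prefix`.
  ascending : List ℕ → List (ℕ × ℕ)
  ascending []      = []
  ascending (l ∷ L) = ascending L ++ (l , a l) ∷ []

  sum-ascending : ∀ L → sum (map proj₂ (ascending L)) ≡ total L
  sum-ascending []      = refl
  sum-ascending (l ∷ L) = begin
    sum (map proj₂ (ascending L ++ (l , a l) ∷ []))  ≡⟨ cong sum (map-++ proj₂ (ascending L) _) ⟩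
    sum (map proj₂ (ascending L) ++ a l ∷ [])        ≡⟨ sum-++ (map proj₂ (ascending L)) _ ⟩
    sum (map proj₂ (ascending L)) + (a l + 0)        ≡⟨ cong₂ _+_ (sum-ascending L) (+-identityʳ (a l)) ⟩
    total L + a l                                    ≡⟨ +-comm (total L) (a l) ⟩
    a l + total L                                    ∎
    where open ≡-Reasoning

  ∈-ascending⁻ : ∀ L {j} → j ∈ map proj₁ (ascending L) → j ∈ L
  ∈-ascending⁻ (l ∷ L) {j} p with ∈-++⁻ (map proj₁ (ascending L)) (subst (j ∈_) (map-++ proj₁ (ascending L) _) p)
  ... | inj₁ q           = there (∈-ascending⁻ L q)
  ... | inj₂ (here refl) = here refl

  ∈-ascending⁺ : ∀ L {j} → j ∈ L → j ∈ map proj₁ (ascending L)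
  ∈-ascending⁺ (l ∷ L) {j} p = subst (j ∈_) (sym (map-++ proj₁ (ascending L) _)) (split p)
    where
    split : j ∈ l ∷ L → j ∈ map proj₁ (ascending L) ++ l ∷ []
    split (here refl) = ∈-++⁺ʳ (map proj₁ (ascending L)) (here refl)
    split (there q)   = ∈-++⁺ˡ (∈-ascending⁺ L q)

  Legal-pairwise : ∀ {n L i j} → Legal S n L → i ∈ L → j ∈ L → S ∣ i - j ∣ ≡ false
  Legal-pairwise (skip p) i∈ j∈ = Legal-pairwise p i∈ j∈
  -- `legal` also tests every index against itself; `S0` settles this case.
  Legal-pairwise {n} (take f p) (here refl) (here refl) = subst (λ d → S d ≡ false) (sym (∣n-n∣≡0 n)) S0
  Legal-pairwise (take f p) (here refl) (there j∈) =
    subst (λ d → S d ≡ false) (sym (m≤n⇒∣n-m∣≡n∸m (m≤n⇒m≤1+n (proj₂ (All.lookup (Legal-bounds p) j∈))))) (All.lookup f j∈)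
  Legal-pairwise (take f p) (there i∈) (here refl) =
    subst (λ d → S d ≡ false) (sym (m≤n⇒∣m-n∣≡n∸m (m≤n⇒m≤1+n (proj₂ (All.lookup (Legal-bounds p) i∈))))) (All.lookup f i∈)
  Legal-pairwise (take f p) (there i∈) (there j∈) = Legal-pairwise p i∈ j∈

  ascending-∈-subsets : ∀ {n L} → Legal S n L → ascending L ∈ subsets (prefix S n)
  ascending-∈-subsets []                 = here refl
  ascending-∈-subsets (skip {n} p)       = subsets-++⁺ˡ (prefix S n) (ascending-∈-subsets p)
  ascending-∈-subsets (take {n} {L} f p) = subsets-++⁺ʳ (prefix S n) (ascending-∈-subsets p)

  subsets⇒Legal : ∀ n P → P ∈ subsets (prefix S n) →
                  (∀ {i j} → i ∈ map proj₁ P → j ∈ map proj₁ P → S ∣ i - j ∣ ≡ false) →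
                  ∃ λ L → Legal S n L × ascending L ≡ P
  subsets⇒Legal zero    P (here refl) f = [] , [] , refl
  subsets⇒Legal (suc n) P P∈ f with subsets-++⁻ (prefix S n) P∈
  ... | inj₁ q with L , p , e ← subsets⇒Legal n P q f = L , skip p , e
  ... | inj₂ (Q , q , refl)
    with L , p , refl ← subsets⇒Legal n Q q (λ i∈ j∈ → f (∈-map-++⁺ˡ Q i∈) (∈-map-++⁺ˡ Q j∈))
    = suc n ∷ L , take (All.tabulate gap) p , refl
    where
    gap : ∀ {j} → j ∈ L → S (suc n ∸ j) ≡ false
    gap {j} j∈ = subst (λ d → S d ≡ false)
      (m≤n⇒∣n-m∣≡n∸m (m≤n⇒m≤1+n (proj₂ (All.lookup (Legal-bounds p) j∈))))
      (f (∈-ascending⁺ (suc n ∷ L) (here refl)) (∈-map-++⁺ˡ (ascending L) (∈-ascending⁺ L j∈)))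

  IsSum⇒∈ : ∀ {n x} → IsSum n x → x ∈ legalSums S (prefix S n)
  IsSum⇒∈ {n} (L , p , refl) = subst (_∈ legalSums S (prefix S n)) (sum-ascending L)
    (legalSums⁺ S (prefix S n) (ascending L) (ascending-∈-subsets p)
      (legal⁺ S _ λ i∈ j∈ → Legal-pairwise p (∈-ascending⁻ L i∈) (∈-ascending⁻ L j∈)))

  ∈⇒IsSum : ∀ {n x} → x ∈ legalSums S (prefix S n) → IsSum n x
  ∈⇒IsSum {n} x∈ with P , P∈ , ok , refl ← legalSums⁻ S (prefix S n) x∈
    with L , p , refl ← subsets⇒Legal n P P∈ (legal⁻ S _ ok) = L , p , sym (sum-ascending L)

  IsSum-0 : ∀ n → IsSum n 0
  IsSum-0 n = [] , empty n , refl

  IsSum-mono : ∀ {m n x} → m ≤ n → IsSum m x → IsSum n x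
  IsSum-mono m≤n (L , p , e) = L , Legal-mono m≤n p , e

  IsSum-single : ∀ {n l} → 1 ≤ l → l ≤ n → IsSum n (a l)
  IsSum-single {n} {l} 1≤l l≤n = l ∷ [] , Legal-mono l≤n (Legal-cons 1≤l [] []) , +-identityʳ (a l)

  IsSum-pair : ∀ {n l j} → 1 ≤ j → j < l → l ≤ n → S (l ∸ j) ≡ false → IsSum n (a l + a j)
  IsSum-pair {n} {l} {j} 1≤j j<l l≤n f =
    l ∷ j ∷ [] , Legal-mono l≤n (Legal-cons j<l (Legal-cons 1≤j [] []) (f ∷ [])) , cong (a l ℕ.+_) (+-identityʳ (a j))

  a-pos : ∀ {n} → 1 ≤ n → 1 ≤ a n
  a-pos {suc n} _ = mexPos-≥1 (legalSums S (prefix S n))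

  below-a : ∀ n {x} → x < a (suc n) → IsSum n x
  below-a n {zero}  _   = IsSum-0 n
  below-a n {suc x} x<a = ∈⇒IsSum (mexPos-below (legalSums S (prefix S n)) (suc x) (s≤s z≤n) x<a)

  a-∉ : ∀ n → ¬ IsSum n (a (suc n))
  a-∉ n p = mexPos-∉ (legalSums S (prefix S n)) (IsSum⇒∈ p)

  a-≥ : ∀ n {v} → (∀ x → x < v → IsSum n x) → v ≤ a (suc n)
  a-≥ n all = ≮⇒≥ λ a<v → a-∉ n (all _ a<v)

  a-≤ : ∀ n {v} → ¬ IsSum n v → a (suc n) ≤ v
  a-≤ n ∉ = ≮⇒≥ λ v<a → ∉ (below-a n v<a)

  -- Values below `a n` are already sums of smaller indices, and `a n` is itself a one-term sum, so
  -- the next mex lies beyond it.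
  a-step : ∀ n → a n < a (suc n)
  a-step zero    = a-pos {1} ≤-refl
  a-step (suc n) = a-≥ (suc n) λ x x≤a → sums x (m≤n⇒m<n∨m≡n (≤-pred x≤a))
    where
    sums : ∀ x → x < a (suc n) ⊎ x ≡ a (suc n) → IsSum (suc n) x
    sums x (inj₁ x<a)  = IsSum-mono (n≤1+n n) (below-a n x<a)
    sums _ (inj₂ refl) = IsSum-single (s≤s z≤n) ≤-refl

  a-grow : ∀ j n → a n + j ≤ a (n + j)
  a-grow zero    n = ≤-reflexive (trans (+-identityʳ (a n)) (cong a (sym (+-identityʳ n))))
  a-grow (suc j) n = subst₂ _≤_ (sym (+-suc (a n) j)) (cong a (sym (+-suc n j))) (≤-trans (s≤s (a-grow j n)) (a-step (n + j)))

  a-mono-≤ : ∀ {m n} → m ≤ n → a m ≤ a n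
  a-mono-≤ {m} {n} m≤n = subst (λ r → a m ≤ a r) (m+[n∸m]≡n m≤n) (≤-trans (m≤m+n (a m) _) (a-grow (n ∸ m) m))

  a-mono-< : ∀ {m n} → m < n → a m < a n
  a-mono-< {m} m<n = ≤-trans (a-step m) (a-mono-≤ m<n)

-- Gaps of the set [k] ∖ (k − T)

¬IsTrue⇒≡false : ∀ {b} → ¬ IsTrue b → b ≡ false
¬IsTrue⇒≡false {false} _ = refl
¬IsTrue⇒≡false {true}  f = contradiction _ f

SkT-false⁻ : ∀ k T g → 1 ≤ g → SkT k T g ≡ false → k < g ⊎ ∃ λ t → t ∈ T × g + t ≡ k
SkT-false⁻ k T (suc g) _ e with suc g ≤ᵇ k in le
... | false = inj₁ (≰⇒> λ g≤k → subst IsTrue le (≤⇒≤ᵇ g≤k))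
... | true with any (λ t → (suc g + t) ≡ᵇ k) T in an
...   | true with t , t∈T , e′ ← find (any⁻ _ T (from T-≡ an)) = inj₂ (t , t∈T , ≡ᵇ⇒≡ (suc g + t) k e′)

SkT-false-far : ∀ k T g → k < g → SkT k T g ≡ false
SkT-false-far k T g k<g = ¬IsTrue⇒≡false λ p →
  <⇒≱ k<g (≤ᵇ⇒≤ g k (proj₁ (to T-∧ (proj₂ (to (T-∧ {1 ≤ᵇ g}) p)))))

module Gaps (T : List ℕ) (c : ℕ) (1≤T : All (1 ≤_) T) (T≤c : All (_≤ c) T) (h : ℕ) where

  k : ℕ
  k = h + c

  S : ℕ → Bool
  S = SkT k T

  open LID S refl public

  gap≥h : ∀ g → 1 ≤ g → S g ≡ false → h ≤ g
  gap≥h g 1≤g e with SkT-false⁻ k T g 1≤g e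
  ... | inj₁ k<g           = ≤-trans (m≤m+n h c) (<⇒≤ k<g)
  ... | inj₂ (t , t∈T , e) = +-cancelʳ-≤ c h g (subst (_≤ g + c) e (+-monoʳ-≤ g (All.lookup T≤c t∈T)))

  gap⇒+h≤ : ∀ {j l} → j < l → S (l ∸ j) ≡ false → j + h ≤ l
  gap⇒+h≤ {j} {l} j<l e = subst (j + h ≤_) (m+[n∸m]≡n (<⇒≤ j<l)) (+-monoʳ-≤ j (gap≥h (l ∸ j) (m<n⇒0<n∸m j<l) e))

  ≤pred⇒< : ∀ {j l} → 1 ≤ l → j ≤ l ∸ 1 → j < l
  ≤pred⇒< {l = suc l} _ j≤l = s≤s j≤l

  -- The tail is anchored at its own top index, which is separated from `l` by a legal gap and hence
  -- by at least `h`.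
  Legal-tail : ∀ {n l L} → Legal S n (l ∷ L) → Legal S (l ∸ h) L
  Legal-tail {L = []}    p = empty _
  Legal-tail {l = l} {L = j ∷ L} p
    with 1≤l , _ , q , f ∷ _ ← Legal-uncons p
    with _ , j≤ , _ ← Legal-uncons q
    = Legal-mono (m+n≤o⇒m≤o∸n j (gap⇒+h≤ (≤pred⇒< 1≤l j≤) f)) (Legal-anchor q)

  -- Third and later terms are kept as a sum over indices up to `j ∸ h`; once `j ≤ h` this forces
  -- `z` to be 0.
  data View (n x : ℕ) : Set where
    none   : x ≡ 0 → View n x
    single : ∀ l → 1 ≤ l → l ≤ n → x ≡ a l → View n x
    multi  : ∀ l j z → 1 ≤ j → j < l → l ≤ n → S (l ∸ j) ≡ false → IsSum (j ∸ h) z → x ≡ a l + (a j + z) → View n x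

  view : ∀ {n x} → IsSum n x → View n x
  view ([] , p , refl) = none refl
  view (l ∷ [] , p , refl) with 1≤l , l≤n , _ ← Legal-uncons p = single l 1≤l l≤n (+-identityʳ (a l))
  view (l ∷ j ∷ L , p , refl)
    with 1≤l , l≤n , q , f ∷ _ ← Legal-uncons p
    with 1≤j , j≤ , _ ← Legal-uncons q
    = multi l j (total L) 1≤j (≤pred⇒< 1≤l j≤) l≤n f (L , Legal-tail q , refl) refl

  Below : ℕ → ℕ → Set
  Below n v = ∀ x → IsSum n x → x < v

  below-0 : Below 0 1
  below-0 _ ([] , _ , refl) = s≤s z≤n

  IsSum-zero : ∀ {z} → IsSum 0 z → z ≡ 0
  IsSum-zero {z} p = n<1⇒n≡0 (below-0 z p)

  -- The top term is at most `a n` by monotonicity, and `Legal-tail` confines the remaining indices.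
  -- Each use peels one term off the bound.
  below-step : ∀ n {v} → Below (n ∸ h) v → Below n (a n + v)
  below-step n b _ ([] , _ , refl) = ≤-trans (b 0 (IsSum-0 (n ∸ h))) (m≤n+m _ (a n))
  below-step n {v} b _ (l ∷ L , p , refl) with _ , l≤n , _ ← Legal-uncons p =
    +-mono-≤-< (a-mono-≤ l≤n) (b (total L) (IsSum-mono (∸-monoˡ-≤ h l≤n) (L , Legal-tail p , refl)))

  below-weaken : ∀ {n v w} → v ≤ w → Below n v → Below n w
  below-weaken v≤w b x p = ≤-trans (b x p) v≤w

  below-short : ∀ n → n ≤ h → Below n (a n + 1)
  below-short n n≤h = below-step n (subst (λ r → Below r 1) (sym (m≤n⇒m∸n≡0 n≤h)) below-0)

  a-suc-≤ : ∀ n {v} → Below n v → a (suc n) ≤ v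
  a-suc-≤ n {v} b = a-≤ n λ p → <-irrefl refl (b v p)

  -- Among indices up to `h` no two are compatible, so each next value exceeds its predecessor by at
  -- most one, and `a` is strictly increasing.
  a-initial : ∀ n → n ≤ suc h → a n ≡ n
  a-initial zero    _         = refl
  a-initial (suc n) (s≤s n≤h) = ≤-antisym
    (subst (a (suc n) ≤_) (trans (+-comm (a n) 1) (cong suc ih)) (a-suc-≤ n (below-short n n≤h)))
    (subst (_< a (suc n)) ih (a-step n))
    where ih = a-initial n (m≤n⇒m≤1+n n≤h)

  -- A number from `a n` up to the claimed bound leaves a remainder below `a (suc q)`, hence a legal
  -- sum of indices up to `q`; these are farther than `k` from `n`, so `n` can be added.
  a-superadditive : ∀ q → a (k + q) + a q ≤ a (suc (k + q))
  a-superadditive zero    = subst (_≤ a (suc (k + 0))) (sym (+-identityʳ _)) (<⇒≤ (a-step (k + 0)))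
  a-superadditive (suc q) = a-≥ n claim
    where
    n = k + suc q
    far : ∀ {j} → j ≤ q → S (n ∸ j) ≡ false
    far {j} j≤q = SkT-false-far k T (n ∸ j) (m+n≤o⇒m≤o∸n (suc k) (subst (suc k + j ≤_) (sym (+-suc k q)) (s≤s (+-monoʳ-≤ k j≤q))))
    claim : ∀ x → x < a n + a (suc q) → IsSum n x
    claim x x<v with x <? a n
    ... | yes x<a rewrite +-suc k q = IsSum-mono (n≤1+n _) (below-a _ x<a)
    ... | no x≮a
      with L , p , e ← below-a q (subst (x ∸ a n <_) (m+n∸m≡n (a n) (a (suc q))) (∸-monoˡ-< x<v (≮⇒≥ x≮a)))
      = n ∷ L , Legal-cons (m≤n+m (suc q) k) p (All.map (λ (_ , j≤q) → far j≤q) (Legal-bounds p))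
        , trans (cong (a n ℕ.+_) e) (m+[n∸m]≡n (≮⇒≥ x≮a))

  -- Superadditivity gives one inequality. For the other, a legal sum equal to the right side must
  -- contain the top index by `b`, and the second index is then either too far down or too large.
  recurrence : ∀ q → Below (k + q) (a (suc (k + q)) + a (suc q)) → a (suc (suc (k + q))) ≡ a (suc (k + q)) + a (suc q)
  recurrence q b = ≤-antisym (a-≤ (suc (k + q)) absent)
    (subst (λ r → a r + a (suc q) ≤ a (suc r)) (+-suc k q) (a-superadditive (suc q)))
    where
    absent : ¬ IsSum (suc (k + q)) (a (suc (k + q)) + a (suc q))
    absent (L , skip p , e) = <-irrefl refl (b _ (L , p , e))
    absent (_ ∷ [] , take _ _ , e) = <-irrefl (+-cancelˡ-≡ (a (suc (k + q))) _ _ e) (a-pos {suc q} (s≤s z≤n))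
    absent (_ ∷ j ∷ L , take (f ∷ _) p , e)
      with _ , j≤n , _ ← Legal-uncons p
      with SkT-false⁻ k T (suc (k + q) ∸ j) (m<n⇒0<n∸m (s≤s j≤n)) f
    -- A gap above `k` makes `a (suc q)` a legal sum of indices up to `q`, contrary to its being a
    -- mex.
    ... | inj₁ far = a-∉ q (j ∷ L , Legal-mono j≤q (Legal-anchor p) , +-cancelˡ-≡ (a (suc (k + q))) _ _ e)
      where
      j≤q : j ≤ q
      j≤q = +-cancelˡ-≤ (suc k) j q (m≤o∸n⇒m+n≤o (suc k) (m≤n⇒m≤1+n j≤n) far)
    -- A gap `k - t` with `t ≥ 1` places `j` above `suc q`, so its term alone exceeds `a (suc q)`.
    ... | inj₂ (t , t∈T , e′) = <⇒≱ (a-mono-< q<j)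
        (subst (a j ≤_) (+-cancelˡ-≡ (a (suc (k + q))) _ _ e) (m≤m+n (a j) (total L)))
      where
      q<j : suc q < j
      q<j = near-gap k q _ j t (≤-reflexive (sym (m∸n+n≡m (m≤n⇒m≤1+n j≤n)))) (≤-reflexive e′) (All.lookup 1≤T t∈T)

-- Raising `k` by one

module Shift (T : List ℕ) (c : ℕ) (1≤T : All (1 ≤_) T) (T≤c : All (_≤ c) T) (h : ℕ) where

  private
    module A = Gaps T c 1≤T T≤c h
    module B = Gaps T c 1≤T T≤c (suc h)

  -- Gap and `k` grow together, so both comparisons with `k` are unchanged; `j < l` makes the
  -- positivity test succeed on both sides.
  gap-suc : ∀ {l j} → j < l → SkT (suc (h + c)) T (suc l ∸ j) ≡ SkT (h + c) T (l ∸ j)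
  gap-suc {l} {j} j<l rewrite +-∸-assoc 1 (<⇒≤ j<l) with l ∸ j | m<n⇒0<n∸m j<l
  ... | suc g | _ = refl

  -- The bound is `suc (h + h)` because this value depends on indices up to `h + h`, where a second
  -- index is at most `h`.
  Shifted : ℕ → Set
  Shifted n = 1 ≤ n → n ≤ suc (h + h) → B.a (suc n) ≡ suc (A.a n)

  module _ (n : ℕ) (n≤2h : n ≤ h + h) (ih : ∀ {l} → l < suc n → Shifted l) where

    shift-l : ∀ {l} → 1 ≤ l → l ≤ n → B.a (suc l) ≡ suc (A.a l)
    shift-l 1≤l l≤n = ih (s≤s l≤n) 1≤l (m≤n⇒m≤1+n (≤-trans l≤n n≤2h))

    initial≡ : ∀ {j} → j ≤ h → A.a j ≡ B.a j
    initial≡ {j} j≤h = trans (A.a-initial j (m≤n⇒m≤1+n j≤h)) (sym (B.a-initial j (m≤n⇒m≤1+n (m≤n⇒m≤1+n j≤h))))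

    sum-shift⁺ : ∀ x → 1 ≤ x → A.IsSum n x → B.IsSum (suc n) (suc x)
    sum-shift⁺ x 1≤x p with A.view p
    ... | A.none refl = contradiction 1≤x λ ()
    ... | A.single l 1≤l l≤n refl = subst (B.IsSum (suc n)) (shift-l 1≤l l≤n) (B.IsSum-single (s≤s z≤n) (s≤s l≤n))
    ... | A.multi l j z 1≤j j<l l≤n f q refl =
      subst (B.IsSum (suc n)) e (B.IsSum-pair 1≤j (m≤n⇒m≤1+n j<l) (s≤s l≤n) (trans (gap-suc j<l) f))
      where
      j≤h : j ≤ h
      j≤h = +-cancelʳ-≤ h j h (≤-trans (A.gap⇒+h≤ j<l f) (≤-trans l≤n n≤2h))
      z≡0 : z ≡ 0
      z≡0 = A.IsSum-zero (subst (λ r → A.IsSum r z) (m≤n⇒m∸n≡0 j≤h) q)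
      e : B.a (suc l) + B.a j ≡ suc (A.a l + (A.a j + z))
      e = cong₂ _+_ (shift-l (≤-trans 1≤j (<⇒≤ j<l)) l≤n)
                    (trans (sym (initial≡ j≤h)) (sym (trans (cong (A.a j ℕ.+_) z≡0) (+-identityʳ _))))

    sum-shift⁻ : ∀ x → 1 ≤ x → B.IsSum (suc n) (suc x) → A.IsSum n x
    sum-shift⁻ x 1≤x p with B.view p
    -- Index 1 is not the successor of a positive index; its value 1 would correspond to `x = 0`.
    ... | B.single (suc zero) 1≤l l≤n e =
      contradiction (subst (1 ≤_) (suc-injective (trans e (B.a-initial 1 (s≤s z≤n)))) 1≤x) λ ()
    ... | B.single (suc l@(suc _)) 1≤l (s≤s l≤n) e =
      subst (A.IsSum n) (sym (suc-injective (trans e (shift-l (s≤s z≤n) l≤n)))) (A.IsSum-single (s≤s z≤n) l≤n)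
    ... | B.multi (suc l) j z 1≤j j<l (s≤s l≤n) f q e =
      subst (A.IsSum n) (sym (suc-injective (trans e e′))) (A.IsSum-pair 1≤j j<l′ l≤n (trans (sym (gap-suc j<l′)) f))
      where
      j+h≤l : j + h ≤ l
      j+h≤l = ≤-pred (subst (_≤ suc l) (+-suc j h) (B.gap⇒+h≤ j<l f))
      j≤h : j ≤ h
      j≤h = +-cancelʳ-≤ h j h (≤-trans j+h≤l (≤-trans l≤n n≤2h))
      j<l′ : j < l
      j<l′ = ≤-trans (subst (_≤ j + h) (+-comm j 1) (+-monoʳ-≤ j (≤-trans 1≤j j≤h))) j+h≤l
      z≡0 : z ≡ 0
      z≡0 = B.IsSum-zero (subst (λ r → B.IsSum r z) (m≤n⇒m∸n≡0 (m≤n⇒m≤1+n j≤h)) q)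
      e′ : B.a (suc l) + (B.a j + z) ≡ suc (A.a l + A.a j)
      e′ = cong₂ _+_ (shift-l (≤-trans 1≤j (<⇒≤ j<l′)) l≤n)
                     (trans (trans (cong (B.a j ℕ.+_) z≡0) (+-identityʳ _)) (sym (initial≡ j≤h)))

    shift-next : B.a (suc (suc n)) ≡ suc (A.a (suc n))
    shift-next = ≤-antisym
      (B.a-≤ (suc n) λ p → A.a-∉ n (sum-shift⁻ _ (A.a-pos {suc n} (s≤s z≤n)) p))
      (B.a-≥ (suc n) sums)
      where
      sums : ∀ x → x < suc (A.a (suc n)) → B.IsSum (suc n) x
      -- 0 and 1 are not successors of positive sums and are represented directly.
      sums zero          _         = B.IsSum-0 (suc n)
      sums (suc zero)    _         = subst (B.IsSum (suc n)) (B.a-initial 1 (s≤s z≤n)) (B.IsSum-single ≤-refl (s≤s z≤n))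
      sums (suc (suc x)) (s≤s x<a) = sum-shift⁺ (suc x) (s≤s z≤n) (A.below-a n x<a)

  shift : ∀ n → Shifted n
  shift = <-rec Shifted λ where
    zero    ih () _
    (suc n) ih _  (s≤s n≤2h) → shift-next n n≤2h ih

-- The surplus inequality and the recurrence, by simultaneous induction

module Growth (T : List ℕ) (c : ℕ) (1≤T : All (1 ≤_) T) (T≤c : All (_≤ c) T) (h D : ℕ)
  (1≤c : 1 ≤ c) (2c≤D : c + c ≤ D) (c≡1⊎2c<D : c ≡ 1 ⊎ c + c < D) (room : c + c + c + D < h) where

  open Gaps T c 1≤T T≤c h

  Recurs : ℕ → Set
  Recurs q = a (suc (suc (k + q))) ≡ a (suc (k + q)) + a (suc q)

  -- For suc q < D the truncated index is 0 and a 0 = 0.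
  Surplus : ℕ → Set
  Surplus q = a (q + c) + a (suc q ∸ D) ≤ a q + a (suc q)

  c≤D : c ≤ D
  c≤D = ≤-trans (m≤m+n c c) 2c≤D

  D≤h : D ≤ h
  D≤h = ≤-trans (m≤n+m D (c + c + c)) (<⇒≤ room)

  2c≤h : c + c ≤ h
  2c≤h = ≤-trans 2c≤D D≤h

  suc≤+c : ∀ q → suc q ≤ q + c
  suc≤+c q = subst (_≤ q + c) (+-comm q 1) (+-monoʳ-≤ q 1≤c)

  surplus-initial : ∀ q → c ≤ q → q + c ≤ suc h → Surplus q
  surplus-initial q c≤q q+c≤
    rewrite a-initial (q + c) q+c≤
          | a-initial (suc q) (≤-trans (suc≤+c q) q+c≤)
          | a-initial q (≤-trans (m≤m+n q c) q+c≤)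
          | a-initial (suc q ∸ D) (≤-trans (m∸n≤m (suc q) D) (≤-trans (suc≤+c q) q+c≤))
          | +-assoc q c (suc q ∸ D)
    = +-monoʳ-≤ q (+-∸-≤ c≤D (m≤n⇒m≤1+n c≤q))

  -- Here `a (q + c)` cancels against `a (suc q)`, and monotonicity finishes since `suc q ∸ D ≤ q`.
  surplus-c≡1 : c ≡ 1 → ∀ q → Surplus q
  surplus-c≡1 refl q = subst (λ r → a r + a (suc q ∸ D) ≤ a q + a (suc q)) (+-comm 1 q)
    (subst (_≤ a q + a (suc q)) (+-comm (a (suc q ∸ D)) (a (suc q)))
      (+-monoˡ-≤ (a (suc q)) (a-mono-≤ (m≤n+o⇒m∸n≤o (suc q) D (+-monoˡ-≤ q c≤D)))))

  -- Passing from `k + i` to its successor, the recurrence expands the top term exactly,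
  -- superadditivity bounds the right side from below, and `star` pays for the move of the `D`-term
  -- from `y` to `suc y`.
  surplus-step : c + c < D → ∀ i → c ≤ i → (∀ q → q < suc (k + i) → c ≤ q → Recurs q) →
                 Surplus (k + i) → Surplus i → Surplus (suc (k + i))
  surplus-step 2c<D i c≤i rec E E₀ =
    subst₂ (λ u v → u + v ≤ a (suc (k + i)) + a (suc (suc (k + i)))) (sym top) (cong a (sym y-suc))
      (surplus-combine (a (k + i + c)) (a (i + c)) (a (suc y)) (a y) (a (k + i)) (a (suc (k + i))) (a i) (a (suc i)) _ _
        E star (a-superadditive i) (subst (λ r → a r + a (suc i) ≤ a (suc r)) (+-suc k i) (a-superadditive (suc i))))
    where
    y = suc (k + i) ∸ D
    D≤ : D ≤ suc (k + i)
    D≤ = ≤-trans D≤h (≤-trans (m≤m+n h c) (≤-trans (m≤m+n k i) (n≤1+n _)))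
    y+D : y + D ≡ suc (k + i)
    y+D = m∸n+n≡m D≤
    y-suc : suc (suc (k + i)) ∸ D ≡ suc y
    y-suc = +-∸-assoc 1 D≤

    -- Chosen so that the recurrence at `p` has lower term `a (i + c)`.
    p = i + c ∸ 1
    suc-p : suc p ≡ i + c
    suc-p = m+[n∸m]≡n (≤-trans 1≤c (m≤n+m c i))
    p<k+i : p < suc (k + i)
    p<k+i = s≤s (≤-trans (≤-trans (n≤1+n p) (≤-reflexive suc-p))
              (subst (i + c ≤_) (+-comm i k) (+-monoʳ-≤ i (m≤n+m c h))))
    c≤p : c ≤ p
    c≤p = ≤-pred (subst (suc c ≤_) (sym suc-p) (≤-trans (s≤s c≤i) (suc≤+c i)))
    k+p : suc (k + p) ≡ k + i + c
    k+p = trans (sym (+-suc k p)) (trans (cong (k ℕ.+_) suc-p) (sym (+-assoc k i c)))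
    top : a (suc (k + i) + c) ≡ a (k + i + c) + a (i + c)
    top = subst₂ (λ u v → a (suc u) ≡ a u + a v) k+p suc-p (rec p p<k+i c≤p)

    initial-terms : i + c ≤ suc h → ∀ u v → i + c + u ≤ v + (i + suc i) → a (i + c) + u ≤ v + (a i + a (suc i))
    initial-terms i+c≤ u v ineq
      rewrite a-initial (i + c) i+c≤ | a-initial i (≤-trans (m≤m+n i c) i+c≤) | a-initial (suc i) (≤-trans (suc≤+c i) i+c≤)
      = ineq

    -- The increment of `a` at `y` has to fit into `a i + a (suc i) - a (i + c)`. It is 1 for
    -- `y ≤ h`, at most `w + 1` for `y ≤ k + c`, and given by the recurrence beyond.
    star : a (i + c) + a (suc y) ≤ a y + (a i + a (suc i))
    star with y ≤? h | y ≤? k + c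
    ... | yes y≤h | _ = initial-terms (early-top≤1+h h c i y D (≤-reflexive (sym y+D)) y≤h D≤h) (a (suc y)) (a y)
      (subst₂ (λ u v → i + c + u ≤ v + (i + suc i)) (sym (a-initial (suc y) (s≤s y≤h))) (sym (a-initial y (m≤n⇒m≤1+n y≤h)))
        (early-increment c i y c≤i))
    ... | no y≰h | yes y≤k+c = initial-terms (middle-top≤1+h h c i y D (≤-reflexive (sym y+D)) y≤k+c room) (a (suc y)) (a y)
      (≤-trans (+-monoʳ-≤ (i + c) next) (middle-increment h c i w D (a y) (≤-reflexive (trans (cong (ℕ._+ D) w+h) y+D)) 2c<D))
      where
      w = y ∸ h
      w+h : w + h ≡ y
      w+h = m∸n+n≡m (<⇒≤ (≰⇒> y≰h))
      w≤h : w ≤ h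
      w≤h = ≤-trans (m≤n+o⇒m∸n≤o y h (subst (y ≤_) (+-assoc h c c) y≤k+c)) 2c≤h
      -- Below a top term of at most `a y`, only a single index up to `w ≤ h` remains.
      next : a (suc y) ≤ a y + (w + 1)
      next = subst (λ r → a (suc y) ≤ a y + (r + 1)) (a-initial w (m≤n⇒m≤1+n w≤h))
               (a-suc-≤ y (below-step y (below-short w w≤h)))
    ... | no _ | no y≰k+c =
      subst (λ r → a (i + c) + r ≤ a y + (a i + a (suc i))) (sym next)
        (subst (_≤ a y + (a i + a (suc i))) (+-left-comm (a y) (a (i + c)) _) (+-monoʳ-≤ (a y) E₀))
      where
      +-left-comm : ∀ u v w → u + (v + w) ≡ v + (u + w)
      +-left-comm u v w = trans (sym (+-assoc u v w)) (trans (cong (ℕ._+ w) (+-comm u v)) (+-assoc v u w))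
      q = y ∸ suc k
      k+q : suc (k + q) ≡ y
      k+q = m+[n∸m]≡n (≤-trans (s≤s (m≤m+n k c)) (≰⇒> y≰k+c))
      c≤q : c ≤ q
      c≤q = +-cancelˡ-≤ (suc k) c q (subst (suc (k + c) ≤_) (sym k+q) (≰⇒> y≰k+c))
      q+D : q + D ≡ i
      q+D = +-period-cancel k D q i (trans (cong (ℕ._+ D) k+q) y+D)
      q≤i : q ≤ i
      q≤i = subst (q ≤_) q+D (m≤m+n q D)
      next : a (suc y) ≡ a y + a (suc i ∸ D)
      next = subst₂ (λ u v → a (suc u) ≡ a u + a v) k+q
               (sym (trans (cong (λ r → suc r ∸ D) (sym q+D)) (m+n∸n≡m (suc q) D)))
               (rec q (s≤s (≤-trans q≤i (m≤n+m i k))) c≤q)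

  module _ (base : ∀ q → suc h < q + c → q ≤ k + c → a (q + c) + suc q ≤ D + (a q + a (suc q))) where

    -- `suc q ∸ D` is untruncated and lies in the identity range, so `base` becomes the surplus
    -- inequality after moving `D` across.
    surplus-base : ∀ q → suc h < q + c → q ≤ k + c → Surplus q
    surplus-base q h<q+c q≤k+c
      rewrite a-initial (suc q ∸ D) (m≤n+o⇒m∸n≤o (suc q) D (1+q≤D+1+h h c q D q≤k+c 2c≤D))
            | sym (+-∸-assoc (a (q + c)) (D≤1+q h c q D h<q+c room))
      = m≤n+o⇒m∸n≤o _ D (base q h<q+c q≤k+c)

    -- The recurrence below `q` is a hypothesis, since it is supplied only by the outer induction in
    -- `bounded-step`.
    surplus-2c<D : c + c < D → ∀ q → c ≤ q → (∀ r → r < q → c ≤ r → Recurs r) → Surplus q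
    surplus-2c<D 2c<D = <-rec (λ q → c ≤ q → (∀ r → r < q → c ≤ r → Recurs r) → Surplus q) step
      where
      step : ∀ q → (∀ {r} → r < q → c ≤ r → (∀ s → s < r → c ≤ s → Recurs s) → Surplus r) →
             c ≤ q → (∀ r → r < q → c ≤ r → Recurs r) → Surplus q
      step q ih c≤q rec with q + c ≤? suc h | q ≤? k + c
      ... | yes q+c≤ | _         = surplus-initial q c≤q q+c≤
      ... | no q+c≰  | yes q≤k+c = surplus-base q (≰⇒> q+c≰) q≤k+c
      ... | no _     | no q≰k+c  =
        subst Surplus k+i (surplus-step 2c<D i c≤i (λ r r< → rec r (subst (r <_) k+i r<))
          (earlier (≤-reflexive k+i) (≤-trans c≤i (m≤n+m i k)))
          (earlier (≤-trans (s≤s (m≤n+m i k)) (≤-reflexive k+i)) c≤i))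
        where
        i = q ∸ suc k
        k+i : suc (k + i) ≡ q
        k+i = m+[n∸m]≡n (≤-trans (s≤s (m≤m+n k c)) (≰⇒> q≰k+c))
        c≤i : c ≤ i
        c≤i = +-cancelˡ-≤ (suc k) c i (subst (suc (k + c) ≤_) (sym k+i) (≰⇒> q≰k+c))
        earlier : ∀ {r} → r < q → c ≤ r → Surplus r
        earlier r<q c≤r = ih r<q c≤r λ s s<r → rec s (<-trans s<r r<q)

    surplus : ∀ q → c ≤ q → (∀ r → r < q → c ≤ r → Recurs r) → Surplus q
    surplus q c≤q rec = [ (λ c≡1 → surplus-c≡1 c≡1 q) , (λ 2c<D → surplus-2c<D 2c<D q c≤q rec) ]′ c≡1⊎2c<D

    Bounded : ℕ → Set
    Bounded q = c ≤ q → Below (k + q) (a (suc (k + q)) + a (suc q))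

    -- Peeling off the index `k + q` leaves indices up to `q + c`, and superadditivity absorbs
    -- `a (k + q) + a q`. For `lower`, `a (q + c)` is peeled off next; `tail` bounds the rest by the
    -- `D`-term of the surplus inequality.
    bounded-step : ∀ q → (∀ {r} → r < q → Bounded r) → Bounded q
    bounded-step q ih c≤q =
      below-weaken (subst (_≤ a (suc (k + q)) + a (suc q)) (+-assoc (a (k + q)) (a q) (a (suc q)))
                     (+-monoˡ-≤ (a (suc q)) (a-superadditive q)))
        (below-step (k + q) (subst (λ r → Below r (a q + a (suc q))) (sym k+q∸h) lower))
      where
      k+q∸h : k + q ∸ h ≡ q + c
      k+q∸h = trans (cong (_∸ h) (+-assoc h c q)) (trans (m+n∸m≡n h (c + q)) (+-comm c q))

      -- The margin serves both cases: `c + c` covers a further term below `k + c`, and 2 covers the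
      -- bound `a (x + 2)` from the induction hypothesis.
      tail : ∀ x → x + h ≡ q + c → Below x (a (x + (c + c) + 2))
      tail x x+h with x <? k + c
      ... | yes x<k+c = below-weaken
              (≤-trans (+-monoʳ-≤ (a x) (subst (λ r → r + 1 ≤ c + c) (sym (a-initial w (m≤n⇒m≤1+n w≤h))) w+1≤))
                (≤-trans (a-grow (c + c) x) (a-mono-≤ (m≤m+n (x + (c + c)) 2))))
              (below-step x (below-short w w≤h))
        where
        w = x ∸ h
        w+1≤ : w + 1 ≤ c + c
        w+1≤ = ∸-room h c x 1≤c x<k+c
        w≤h : w ≤ h
        w≤h = ≤-trans (m≤m+n w 1) (≤-trans w+1≤ 2c≤h)
      ... | no x≮k+c = below-weaken (subst (_≤ a (x + (c + c) + 2)) next (a-mono-≤ x+2≤))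
              (subst (λ r → Below r (a (suc r) + a (suc r′))) k+r′ (ih r′<q c≤r′))
        where
        r′ = x ∸ k
        k+r′ : k + r′ ≡ x
        k+r′ = m+[n∸m]≡n (≤-trans (m≤m+n k c) (≮⇒≥ x≮k+c))
        c≤r′ : c ≤ r′
        c≤r′ = +-cancelˡ-≤ k c r′ (subst (k + c ≤_) (sym k+r′) (≮⇒≥ x≮k+c))
        r′<q : r′ < q
        r′<q = two-gaps-earlier h c q r′ (≤-trans 1≤c (≤-trans (m≤m+n c c) 2c≤h)) (≤-reflexive (trans (cong (ℕ._+ h) k+r′) x+h))
        next : a (suc (suc x)) ≡ a (suc x) + a (suc r′)
        next = subst (λ r → a (suc (suc r)) ≡ a (suc r) + a (suc r′)) k+r′ (recurrence r′ (ih r′<q c≤r′))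
        x+2≤ : suc (suc x) ≤ x + (c + c) + 2
        x+2≤ = subst (_≤ x + (c + c) + 2) (+-comm x 2) (+-monoˡ-≤ 2 (m≤m+n x (c + c)))

      lower : Below (q + c) (a q + a (suc q))
      lower with q + c ≤? h
      ... | yes q+c≤h = below-weaken bound (below-short (q + c) q+c≤h)
        where
        bound : a (q + c) + 1 ≤ a q + a (suc q)
        bound rewrite a-initial (q + c) (m≤n⇒m≤1+n q+c≤h)
                    | a-initial (suc q) (≤-trans (suc≤+c q) (m≤n⇒m≤1+n q+c≤h))
                    | a-initial q (≤-trans (m≤m+n q c) (m≤n⇒m≤1+n q+c≤h))
                    | +-assoc q c 1 | +-comm c 1 = +-monoʳ-≤ q (s≤s c≤q)
      ... | no q+c≰h = below-weaken (surplus q c≤q (λ r r<q c≤r → recurrence r (ih r<q c≤r)))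
              (below-step (q + c) (below-weaken (a-mono-≤ (m+n≤o⇒m≤o∸n (x + (c + c) + 2) {D} (tail-room h c q D x (≤-reflexive x+h) room))) (tail x x+h)))
        where
        x = q + c ∸ h
        x+h : x + h ≡ q + c
        x+h = m∸n+n≡m (<⇒≤ (≰⇒> q+c≰h))

    recurs : ∀ q → c ≤ q → Recurs q
    recurs q c≤q = recurrence q (<-rec Bounded bounded-step q c≤q)

-- The values f_T and d

-- For `ν = κ + i` the room condition reads `κ ≥ i + 2c - 1`. It survives raising both indices, so
-- the one-step shift iterates.
aK-shift : ∀ T c → All (1 ≤_) T → All (_≤ c) T → ∀ κ ν → 1 ≤ ν → ν + (c + c) ≤ suc (κ + κ) → ∀ j →
           aK T (j + κ) (j + ν) ≡ j + aK T κ ν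
aK-shift T c 1≤T T≤c κ ν 1≤ν room zero    = refl
aK-shift T c 1≤T T≤c κ ν 1≤ν room (suc j) = trans (shift-one (j + κ) (j + ν) (≤-trans 1≤ν (m≤n+m ν j)) (room-shift j κ ν c room))
  (cong suc (aK-shift T c 1≤T T≤c κ ν 1≤ν room j))
  where
  shift-one : ∀ k n → 1 ≤ n → n + (c + c) ≤ suc (k + k) → aK T (suc k) (suc n) ≡ suc (aK T k n)
  shift-one k n 1≤n r with k ∸ c | m∸n+n≡m (room⇒c≤k n c k 1≤n r)
  ... | h | refl = Shift.shift T c 1≤T T≤c h n 1≤n (room⇒n≤1+2h h c n r)

-- The canonical `K` is the least admissible choice, so every admissible `k` is reached from it by
-- upward shifts.
fT-value : ∀ T c → All (1 ≤_) T → All (_≤ c) T → 1 ≤ c → ∀ k q i → + q ≡ + k ℤ.+ i → 1 ≤ q →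
           q + (c + c) ≤ suc (k + k) → fT T c i ≡ + aK T k q - + k
fT-value T c 1≤T T≤c 1≤c k q i q≡ 1≤q room = begin
  + aK T κ ν - K                    ≡⟨ cong (λ r → + aK T κ ν - r) (sym κ≡) ⟩
  + aK T κ ν - + κ                  ≡⟨ sym (+-cancelˡ-difference (+ j) (+ aK T κ ν) (+ κ)) ⟩
  + (j + aK T κ ν) - + (j + κ)      ≡⟨ cong (λ r → + r - + (j + κ)) (sym (aK-shift T c 1≤T T≤c κ ν 1≤ν room₀ j)) ⟩
  + aK T (j + κ) (j + ν) - + (j + κ) ≡⟨ cong₂ (λ u v → + aK T u v - + u) j+κ j+ν ⟩
  + aK T k q - + k                  ∎
  where
  open ≡-Reasoning
  K₁ K : ℤ
  K₁ = (+ 1) ⊔ ((+ 1) - i)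
  K = K₁ ⊔ (i ℤ.+ + (2 * c) - + 1)
  κ ν : ℕ
  κ = ℤ.∣ K ∣
  ν = ℤ.∣ K ℤ.+ i ∣
  2c≡ : 2 * c ≡ c + c
  2c≡ = cong (c ℕ.+_) (+-identityʳ c)
  1≤K : + 1 ℤ.≤ K
  1≤K = ℤ.≤-trans (ℤ.i≤i⊔j (+ 1) ((+ 1) - i)) (ℤ.i≤i⊔j K₁ _)
  κ≡ : + κ ≡ K
  κ≡ = ℤ.0≤i⇒+∣i∣≡i (ℤ.≤-trans (ℤ.+≤+ z≤n) 1≤K)
  1≤K+i : + 1 ℤ.≤ K ℤ.+ i
  1≤K+i = 1-i≤K⇒1≤K+i K i (ℤ.≤-trans (ℤ.i≤j⊔i (+ 1) ((+ 1) - i)) (ℤ.i≤i⊔j K₁ _))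
  ν≡ : + ν ≡ K ℤ.+ i
  ν≡ = ℤ.0≤i⇒+∣i∣≡i (ℤ.≤-trans (ℤ.+≤+ z≤n) 1≤K+i)
  1≤ν : 1 ≤ ν
  1≤ν = ℤ.drop‿+≤+ (subst (+ 1 ℤ.≤_) (sym ν≡) 1≤K+i)
  room₀ : ν + (c + c) ≤ suc (κ + κ)
  room₀ = ℤ.drop‿+≤+ (subst₂ (λ u v → u ℤ.+ + (c + c) ℤ.≤ + 1 ℤ.+ (v ℤ.+ v)) (sym ν≡) (sym κ≡)
    (subst (λ r → K ℤ.+ i ℤ.+ + r ℤ.≤ + 1 ℤ.+ (K ℤ.+ K)) 2c≡ (i+C-1≤K⇒K+i+C≤1+2K K i (+ (2 * c)) (ℤ.i≤j⊔i K₁ _))))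
  K≤k : K ℤ.≤ + k
  K≤k = ℤ.⊔-lub (ℤ.⊔-lub (ℤ.+≤+ (≤-trans 1≤c (room⇒c≤k q c k 1≤q room))) (1≤k+i⇒1-i≤k (+ k) i (+ q) q≡ (ℤ.+≤+ 1≤q)))
    (k+i+C≤1+2k⇒i+C-1≤k (+ k) i (+ q) (+ (2 * c)) q≡ (subst (λ r → + (q + r) ℤ.≤ + suc (k + k)) (sym 2c≡) (ℤ.+≤+ room)))
  j : ℕ
  j = k ∸ κ
  j+κ : j + κ ≡ k
  j+κ = m∸n+n≡m (ℤ.drop‿+≤+ (subst (ℤ._≤ + k) (sym κ≡) K≤k))
  j+ν : j + ν ≡ q
  j+ν = ℤ.+-injective (begin
    + j ℤ.+ + ν            ≡⟨ cong (λ r → + j ℤ.+ r) ν≡ ⟩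
    + j ℤ.+ (K ℤ.+ i)      ≡⟨ sym (ℤ.+-assoc (+ j) K i) ⟩
    + j ℤ.+ K ℤ.+ i        ≡⟨ cong (λ r → + j ℤ.+ r ℤ.+ i) (sym κ≡) ⟩
    + (j + κ) ℤ.+ i        ≡⟨ cong (λ r → + r ℤ.+ i) j+κ ⟩
    + k ℤ.+ i              ≡⟨ sym q≡ ⟩
    + q                    ∎)

dTerm : List ℕ → ℕ → ℤ → ℤ
dTerm T c i = fT T c (i ℤ.+ + c) - fT T c i - fT T c (i ℤ.+ + 1) ℤ.+ i ℤ.+ + 1

dVal-≥ : ∀ T c m j → + j ℤ.≤ + (c + m) - (+ 2 - + (2 * c)) →
         dTerm T c (+ 2 - + (2 * c) ℤ.+ + j) ℤ.≤ dVal T c m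
dVal-≥ T c m j j≤ = ℤ.≤-trans
  (maxFrom-≥ (+ 2 - + (2 * c)) _ (dTerm T c) j
    (ℤ.drop‿+≤+ (subst (+ j ℤ.≤_) (sym (ℤ.0≤i⇒+∣i∣≡i (ℤ.≤-trans (ℤ.+≤+ z≤n) j≤))) j≤)))
  (ℤ.i≤j⊔i (+ (2 * c + m) - + 1) _)

-- The entry `2c + m - 1` of the maximum is nonnegative, so the absolute value represents `d`
-- faithfully as a natural number.
∣dVal∣-bound : ∀ T c m → 1 ≤ c → + ℤ.∣ dVal T c m ∣ ≡ dVal T c m × 2 * c + m ≤ suc ℤ.∣ dVal T c m ∣
∣dVal∣-bound T c m 1≤c = e , ℤ.drop‿+≤+ (x-1≤D⇒x≤1+D (+ (2 * c + m)) (+ ℤ.∣ dVal T c m ∣) (subst (+ (2 * c + m) - + 1 ℤ.≤_) (sym e) lower))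
  where
  lower : + (2 * c + m) - + 1 ℤ.≤ dVal T c m
  lower = ℤ.i≤i⊔j _ _
  e : + ℤ.∣ dVal T c m ∣ ≡ dVal T c m
  e = ℤ.0≤i⇒+∣i∣≡i (ℤ.≤-trans (ℤ.i≤j⇒0≤j-i (ℤ.+≤+ (≤-trans 1≤c (≤-trans (m≤m+n c (c + 0)) (m≤m+n (2 * c) m))))) lower)

-- The quadratic enters only through lower bounds on `m`: 1 for `c = 1`, and 2 otherwise, which
-- makes `c + c < D` strict.
d-size : ∀ c m D → 1 ≤ c → GoodM c m → 2 * c + m ≤ suc D → c + c ≤ D × (c ≡ 1 ⊎ c + c < D)
d-size (suc zero) m D _ good p = 1≤m⇒2≤D m D (GoodM1⇒1≤m m good) p , inj₁ refl
d-size c@(suc (suc _)) m D _ good p = <⇒≤ q , inj₂ q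
  where
  q : c + c < D
  q = 2≤m⇒2c<D c m D (GoodM⇒2≤m c m (s≤s (s≤s z≤n)) good) p

-- In this window `i = q - k` lies in the range of the maximum defining `d`, and `fT-value` turns
-- its term at `i` into values of `a`.
base-surplus : ∀ T c → All (1 ≤_) T → All (_≤ c) T → 1 ≤ c → ∀ m h D → + D ≡ dVal T c m → c + c + c + D < h →
               ∀ q → suc h < q + c → q ≤ h + c + c →
               aK T (h + c) (q + c) + suc q ≤ D + (aK T (h + c) q + aK T (h + c) (suc q))
base-surplus T c 1≤T T≤c 1≤c m h D D≡ room q h<q+c q≤ =
  ℤ.drop‿+≤+ (dTerm⇒surplus (+ a (q + c)) (+ a q) (+ a (suc q)) (+ k) (+ q) (+ D) i q≡
    (subst₂ ℤ._≤_ values (sym D≡) (dVal-≥ T c m j j≤)))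
  where
  k : ℕ
  k = h + c
  a : ℕ → ℕ
  a = aK T k
  j : ℕ
  j = q + c ∸ (h + 2)
  q+c≡ : q + c ≡ h + 2 + j
  q+c≡ = sym (m+[n∸m]≡n (subst (_≤ q + c) (+-comm 2 h) h<q+c))
  i : ℤ
  i = + 2 - + (2 * c) ℤ.+ + j
  q≡ : + q ≡ + k ℤ.+ i
  q≡ = subst (λ r → + q ≡ + k ℤ.+ (+ 2 - r ℤ.+ + j)) (sym (ℤ.pos-* 2 c)) (index-from-offset (+ q) (+ c) (+ h) (+ j) (cong +_ q+c≡))
  j≤ : + j ℤ.≤ + (c + m) - (+ 2 - + (2 * c))
  j≤ = subst (λ r → + j ℤ.≤ + (c + m) - (+ 2 - r)) (sym (ℤ.pos-* 2 c))
    (offset≤range (+ j) (+ c) (+ m) (ℤ.+≤+ (offset+2≤3c h c q j q+c≡ q≤)) (ℤ.+≤+ z≤n))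
  1≤q : 1 ≤ q
  1≤q = window⇒1≤q h c D q h<q+c room
  value : ∀ x i′ → + x ≡ + k ℤ.+ i′ → 1 ≤ x → x ≤ q + c → fT T c i′ ≡ + a x - + k
  value x i′ x≡ 1≤x x≤ = fT-value T c 1≤T T≤c 1≤c k x i′ x≡ 1≤x (window-room h c D q x x≤ q≤ room)
  values : dTerm T c i ≡
           (+ a (q + c) - + k) - (+ a q - + k) - (+ a (suc q) - + k) ℤ.+ i ℤ.+ + 1
  values = cong (λ r → r ℤ.+ i ℤ.+ + 1) (cong₂ _-_
    (cong₂ _-_ (value (q + c) (i ℤ.+ + c) (index-+ (+ q) (+ k) i (+ c) q≡) (≤-trans 1≤q (m≤m+n q c)) ≤-refl)
               (value q i q≡ 1≤q (m≤m+n q c)))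
    (value (suc q) (i ℤ.+ + 1) (trans (cong +_ (+-comm 1 q)) (index-+ (+ q) (+ k) i (+ 1) q≡)) (s≤s z≤n)
      (subst (_≤ q + c) (+-comm q 1) (+-monoʳ-≤ q 1≤c))))

theorem3p10 : (T : List ℕ) (c : ℕ) → All (λ t → 1 ≤ t) T → c ∈ T → All (λ t → t ≤ c) T
    → (m : ℕ) → GoodM c m → (∀ (m′ : ℕ) → GoodM c m′ → m ≤ m′)
    → (k : ℕ)
    → ((+ 2 ℤ.* dVal T c m - + (4 * c) ℤ.+ + 2) ⊔ (+ (4 * c + 1) ℤ.+ dVal T c m)) ℤ.≤ + k
    → maxRange (+ 2 - + (2 * c)) (+ (c + 2) ℤ.+ dVal T c m)
    (λ i → fT T c (i - + 1 ℤ.+ + c) - fT T c (i - + 1) - fT T c i ℤ.+ i ℤ.+ + (2 * c) - + 1)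
    ℤ.< + k
    → ∀ (n : ℕ) → k + c < n → aK T k (suc n) ≡ aK T k n + aK T k (n ∸ k)
theorem3p10 T c 1≤T c∈T T≤c m good _ k k≥ _ n k+c<n
  with D≡ , D≥ ← ∣dVal∣-bound T c m (All.lookup 1≤T c∈T)
  = main (k ∸ c) (m∸n+n≡m c≤k)
  where
  D : ℕ
  D = ℤ.∣ dVal T c m ∣
  1≤c : 1 ≤ c
  1≤c = All.lookup 1≤T c∈T
  D≤k : 4 * c + 1 + D ≤ k
  D≤k = ℤ.drop‿+≤+ (subst (λ r → + (4 * c + 1) ℤ.+ r ℤ.≤ + k) (sym D≡) (ℤ.i⊔j≤k⇒j≤k (+ 2 ℤ.* dVal T c m - + (4 * c) ℤ.+ + 2) _ k≥))
  c≤k : c ≤ k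
  c≤k = ≤-trans (m≤m+n c (3 * c)) (≤-trans (m≤m+n (4 * c) 1) (≤-trans (m≤m+n (4 * c + 1) D) D≤k))
  q : ℕ
  q = n ∸ suc k
  -- In terms of `q`, the hypothesis `k + c < n` is exactly `c ≤ q`.
  n≡ : suc (k + q) ≡ n
  n≡ = m+[n∸m]≡n (≤-trans (s≤s (m≤m+n k c)) k+c<n)
  c≤q : c ≤ q
  c≤q = +-cancelˡ-≤ (suc k) c q (subst (suc (k + c) ≤_) (sym n≡) k+c<n)
  n∸k : n ∸ k ≡ suc q
  n∸k = trans (cong (_∸ k) (trans (sym n≡) (sym (+-suc k q)))) (m+n∸m≡n k (suc q))
  main : ∀ h → h + c ≡ k → aK T k (suc n) ≡ aK T k n + aK T k (n ∸ k)
  main h h+c = subst₂ (λ u v → aK T k (suc u) ≡ aK T k u + aK T k v) n≡ (sym n∸k)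
    (subst (λ k → aK T k (suc (suc (k + q))) ≡ aK T k (suc (k + q)) + aK T k (suc q)) h+c
      (recurs (base-surplus T c 1≤T T≤c 1≤c m h D D≡ room) q c≤q))
    where
    room : c + c + c + D < h
    room = k-room⇒h-room h c D (subst (4 * c + 1 + D ≤_) (sym h+c) D≤k)
    sizes : c + c ≤ D × (c ≡ 1 ⊎ c + c < D)
    sizes = d-size c m D 1≤c good D≥
    open Growth T c 1≤T T≤c h D 1≤c (proj₁ sizes) (proj₂ sizes) room
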